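{- Assume the following statement holds: for every tournament $T$ there exists a constant $\epsilon>0$ such that every tournament on $n$ vertices contains either a copy of $T$ or a transitive tournament on $n^{\epsilon}$ vertices. Then for every $k\in\mathbb N$ there exist constants $c,d$ such that every acyclic oriented graph $H$ in which every vertex has out-degree at most $k$ satisfies $\tau(H)\le c\,p(H)^d$.
   Context: An oriented graph is a directed graph with no loops in which any two vertices are joined by at most one arc; a tournament is an orientation of a complete graph. A homomorphism $H\to T$ of oriented graphs is a map $V(H)\to V(T)$ sending every arc $uv$ of $H$ to an arc $f(u)f(v)$ of $T$. The compressibility $\tau(H)$ of an oriented graph $H$ is the smallest $k\in\mathbb N$ such that for every tournament $T$ on $k$ vertices there is a homomorphism $H\to T$ (and $\tau(H)=\infty$ if no such $k$ exists). For an acyclic oriented graph $H$, $p(H)$ denotes the maximum number of vertices of a directed path in $H$. -}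

module Defs where

open import Data.Nat using (ℕ; _≤_; _^_; _*_; _<_)
open import Data.Fin using (Fin)
open import Data.Bool using (Bool; true; false)
open import Data.List using (List; []; _∷_; _++_; length; filterᵇ; allFin)
open import Data.List.Relation.Unary.Linked using (Linked)
open import Data.List.Relation.Unary.AllPairs using (AllPairs)
open import Data.List.Relation.Unary.Unique.Propositional using (Unique)
open import Data.Product using (Σ; ∃; _×_; _,_)
open import Data.Sum using (_⊎_)
open import Relation.Binary.PropositionalEquality using (_≡_; _≢_)
open import Relation.Nullary using (¬_)
open import Function.Definitions using (Injective)

record OrientedGraph : Set where
  field
    size     : ℕ
    arc      : Fin size → Fin size → Bool
    loopless : ∀ v → arc v v ≡ false
    asym     : ∀ u v → arc u v ≡ true → arc v u ≡ false

open OrientedGraph public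

Arc : (H : OrientedGraph) → Fin (size H) → Fin (size H) → Set
Arc H u v = arc H u v ≡ true

IsTournament : OrientedGraph → Set
IsTournament G = ∀ u v → u ≢ v → Arc G u v ⊎ Arc G v u

Hom : OrientedGraph → OrientedGraph → Set
Hom H T = Σ (Fin (size H) → Fin (size T)) λ f →
  ∀ u v → Arc H u v → Arc T (f u) (f v)

CompressesTo : OrientedGraph → ℕ → Set
CompressesTo H k = ∀ (T : OrientedGraph) → size T ≡ k → IsTournament T → Hom H T

-- τ(H) ≤ m  (τ(H) is the least k with CompressesTo H k; ∞ if none).
τ≤ : OrientedGraph → ℕ → Set
τ≤ H m = Σ ℕ λ k → k ≤ m × CompressesTo H k

IsDirectedPath : (H : OrientedGraph) → List (Fin (size H)) → Set
IsDirectedPath H vs = Unique vs × Linked (Arc H) vs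

IsMaxPathSize : OrientedGraph → ℕ → Set
IsMaxPathSize H p =
  (Σ (List (Fin (size H))) λ vs → IsDirectedPath H vs × length vs ≡ p)
  × (∀ vs → IsDirectedPath H vs → length vs ≤ p)

Acyclic : OrientedGraph → Set
Acyclic H = ∀ v vs → ¬ Linked (Arc H) (v ∷ vs ++ v ∷ [])

OutDegAtMost : OrientedGraph → ℕ → Set
OutDegAtMost H k = ∀ v → length (filterᵇ (arc H v) (allFin (size H))) ≤ k

-- G contains a copy of T (injective homomorphism; for tournaments this is
-- a subtournament isomorphic to T).
ContainsCopy : OrientedGraph → OrientedGraph → Set
ContainsCopy G T = Σ (Hom T G) λ h → Injective _≡_ _≡_ (Data.Product.proj₁ h)
  where import Data.Product

IsTransitiveSub : (G : OrientedGraph) → List (Fin (size G)) → Set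
IsTransitiveSub G vs = AllPairs (Arc G) vs

-- Erdős–Hajnal conjecture for tournaments, with ε = a / b (a, b > 0):
-- every tournament T has ε > 0 such that every n-vertex tournament contains
-- T or a transitive subtournament on at least n^ε vertices, i.e. on t
-- vertices with t^b ≥ n^a.
ErdosHajnalTournaments : Set
ErdosHajnalTournaments =
  ∀ (T : OrientedGraph) → IsTournament T →
    Σ ℕ λ a → Σ ℕ λ b → 0 < a × 0 < b ×
      (∀ (G : OrientedGraph) → IsTournament G →
        ContainsCopy G T
        ⊎ (Σ (List (Fin (size G))) λ vs →
             IsTransitiveSub G vs × size G ^ a ≤ length vs ^ b))

-- By the Erdős–Hajnal hypothesis it suffices to exhibit, for each k, one
-- tournament to which every acyclic H of out-degree at most k maps: a tournament
-- on p ^ b vertices without a copy of it has a transitive subtournament on p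
-- vertices, and H maps to that one by sending each vertex to its height.
-- A suitable tournament is one in which any k vertices have a common in-neighbour,
-- since H can then be mapped greedily, sinks first.  For k = 2 the Paley tournament
-- on 7 vertices has this property.  It passes from k to k + 1 (k ≥ 2) by taking
-- triples of vertices with the majority rule: given k + 1 triples, let the c-th
-- coordinate dominate the c-th coordinates of all of them except the c-th one, so
-- that each of the given triples is beaten in at least two coordinates.
module Submission where

open import Defs
open import Data.Bool using (Bool; true; false; _∧_; _∨_; not; if_then_else_)
import Data.Bool.Properties as Bool
open import Data.Fin using (Fin; zero; suc; toℕ; fromℕ<; punchIn; finToFun; funToFin)
open import Data.Fin.Properties
  using (all?; any?; finToFun-funToFin; toℕ-fromℕ<)
  renaming (_≟_ to _≟ᶠ_; _<?_ to _<ᶠ?_; <-cmp to <ᶠ-cmp; <-irrefl to <ᶠ-irrefl)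
open import Data.List using (List; []; _∷_; _++_; length; map; filterᵇ; allFin; lookup)
open import Data.List.Extrema.Nat using (max; xs≤max; argmax-all)
open import Data.List.Membership.Propositional using (_∈_; _∉_)
open import Data.List.Membership.Propositional.Properties
  using (∈-∃++; ∈-allFin; ∈-filter⁺; ∈-filter⁻; ∈-map⁺; ∈-lookup)
open import Data.List.Properties using (++-assoc; map-cong-local)
open import Data.List.Relation.Unary.All as All using (All; []; _∷_)
import Data.List.Relation.Unary.All.Properties as All
open import Data.List.Relation.Unary.AllPairs using (AllPairs; []; _∷_)
open import Data.List.Relation.Unary.Any using (here; there)
open import Data.List.Relation.Unary.Linked as Linked using (Linked; []; [-]; _∷_)
open import Data.List.Relation.Unary.Unique.Propositional using (Unique)
open import Data.Nat using (ℕ; zero; suc; _+_; _∸_; _*_; _^_; _%_; _≤_; _<_; z≤n; s≤s;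
  s<s⁻¹; s≤s⁻¹; >-nonZero)
open import Data.Nat.Properties
open import Data.Product using (Σ; ∃; _×_; _,_; proj₁; proj₂)
open import Data.Sum using (inj₁; inj₂)
open import Data.Vec.Functional using () renaming (_∷_ to _∷ᶠ_)
open import Function using (_∘_; id; const)
open import Function.Bundles using (Equivalence)
open import Relation.Binary.Definitions using (tri<; tri≈; tri>)
open import Relation.Binary.PropositionalEquality
open import Relation.Nullary using (does; yes; no; contradiction)
open import Relation.Nullary.Decidable
  using (_⊎-dec_; _×-dec_; _→-dec_; ¬?; from-yes; dec-true; dec-false; T?)

-- Tournaments with common in-neighbours.

Dominating : OrientedGraph → ℕ → Set
Dominating T k = ∀ (w : Fin k → Fin (size T)) → ∃ λ u → ∀ i → Arc T u (w i)

module Completion {n} (R : Fin n → Fin n → Bool)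
                  (R-asym : ∀ u v → R u v ≡ true → R v u ≡ false) where

  R-irrefl : ∀ v → R v v ≡ false
  R-irrefl v with R v v in eq
  ... | false = refl
  ... | true  = trans (sym eq) (R-asym v v eq)

  -- In the cube below, two triples that agree in a coordinate may have no majority winner.
  -- Domination is shown through decided pairs only, so the others can follow the order of `Fin`.
  completeArc : Fin n → Fin n → Bool
  completeArc u v = R u v ∨ (not (R v u) ∧ does (u <ᶠ? v))

  completeArc-asym : ∀ u v → completeArc u v ≡ true → completeArc v u ≡ false
  completeArc-asym u v e with R u v in uv | R v u in vu
  ... | true  | true  = contradiction (trans (sym vu) (R-asym u v uv)) λ ()
  ... | true  | false = refl
  completeArc-asym u v () | false | true
  ... | false | false with u <ᶠ? v
  ...   | yes u<v = dec-false (v <ᶠ? u) (<-asym u<v)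
  ...   | no  u≮v = contradiction (trans (sym e) (dec-false (u <ᶠ? v) u≮v)) λ ()

  completion : OrientedGraph
  completion = record
    { size     = n
    ; arc      = completeArc
    ; loopless = λ v → cong₂ (λ a b → a ∨ (not a ∧ b)) (R-irrefl v)
                             (dec-false (v <ᶠ? v) (<ᶠ-irrefl refl))
    ; asym     = completeArc-asym
    }

  R⇒completeArc : ∀ {u v} → R u v ≡ true → completeArc u v ≡ true
  R⇒completeArc e rewrite e = refl

  completion-isTournament : IsTournament completion
  completion-isTournament u v u≢v with R u v in uv | R v u in vu
  ... | true  | _     = inj₁ refl
  ... | false | true  = inj₂ refl
  ... | false | false with <ᶠ-cmp u v
  ...   | tri< u<v _ _ = inj₁ (dec-true (u <ᶠ? v) u<v)
  ...   | tri≈ _ u≡v _ = contradiction u≡v u≢v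
  ...   | tri> _ _ v<u = inj₂ (dec-true (v <ᶠ? u) v<u)

majority : Bool → Bool → Bool → Bool
majority a b c = (a ∧ b) ∨ (b ∧ c) ∨ (c ∧ a)

majority-outer : ∀ b → majority true b true ≡ true
majority-outer true  = refl
majority-outer false = refl

-- Two true arguments force the two opposite ones to be false, and two false arguments settle a
-- majority.
majority-opposed : ∀ a b c {a′ b′ c′} →
  (a ≡ true → a′ ≡ false) → (b ≡ true → b′ ≡ false) → (c ≡ true → c′ ≡ false) →
  majority a b c ≡ true → majority a′ b′ c′ ≡ false
majority-opposed true true c {c′ = c′} f g h _
  rewrite f refl | g refl = Bool.∧-zeroʳ c′
majority-opposed true false true {b′ = b′} f g h _
  rewrite f refl | h refl | Bool.∧-zeroʳ b′ = refl
majority-opposed true false false _ _ _ ()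
majority-opposed false true false _ _ _ ()
majority-opposed false false true _ _ _ ()
majority-opposed false false false _ _ _ ()
majority-opposed false true true {a′ = a′} f g h _
  rewrite g refl | h refl | Bool.∧-zeroʳ a′ = refl

module Cube (T : OrientedGraph) where

  coord : Fin (size T ^ 3) → Fin 3 → Fin (size T)
  coord = finToFun

  beats : Fin (size T ^ 3) → Fin (size T ^ 3) → Fin 3 → Bool
  beats u v c = arc T (coord u c) (coord v c)

  wins : Fin (size T ^ 3) → Fin (size T ^ 3) → Bool
  wins u v = majority (beats u v zero) (beats u v (suc zero)) (beats u v (suc (suc zero)))

  wins-asym : ∀ u v → wins u v ≡ true → wins v u ≡ false
  wins-asym u v = majority-opposed
    (beats u v zero) (beats u v (suc zero)) (beats u v (suc (suc zero)))
    (beats-asym zero) (beats-asym (suc zero)) (beats-asym (suc (suc zero)))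
    where
    beats-asym : ∀ c → beats u v c ≡ true → beats v u c ≡ false
    beats-asym c = asym T (coord u c) (coord v c)

  open Completion wins wins-asym public

  dominating-cube : ∀ {k} → Dominating T (2 + k) → Dominating completion (3 + k)
  dominating-cube {k} dom w = u , λ i → R⇒completeArc (u-wins i)
    where
    c₀ c₁ c₂ : Fin 3
    c₀ = zero
    c₁ = suc zero
    c₂ = suc (suc zero)

    -- Different coordinates omit different triples, so each triple is omitted at most once. This
    -- takes three triples, which is why the induction starts from 2.
    omit : Fin 3 → Fin (3 + k)
    omit zero             = zero
    omit (suc zero)       = suc zero
    omit (suc (suc zero)) = suc (suc zero)

    dominator : ∀ c → ∃ λ x → ∀ i → Arc T x (coord (w (punchIn (omit c) i)) c)
    dominator c = dom (λ i → coord (w (punchIn (omit c) i)) c)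

    u : Fin (size T ^ 3)
    u = funToFin (proj₁ ∘ dominator)

    beaten : ∀ c i → beats u (w (punchIn (omit c) i)) c ≡ true
    beaten c i rewrite finToFun-funToFin (proj₁ ∘ dominator) c = proj₂ (dominator c) i

    -- The index passed to `beaten` is the position of the triple after the one omitted at that
    -- coordinate is removed.
    u-wins : ∀ i → wins u (w i) ≡ true
    u-wins zero
      rewrite beaten c₁ zero | beaten c₂ zero = Bool.∨-zeroʳ _
    u-wins (suc zero)
      rewrite beaten c₀ zero | beaten c₂ (suc zero) = majority-outer (beats u (w (suc zero)) c₁)
    u-wins (suc (suc zero))
      rewrite beaten c₀ (suc zero) | beaten c₁ (suc zero) = refl
    u-wins (suc (suc (suc i)))
      rewrite beaten c₀ (suc (suc i)) | beaten c₁ (suc (suc i)) = refl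

-- 1, 2 and 4 are the nonzero squares modulo 7.
paley₇Arc : Fin 7 → Fin 7 → Bool
paley₇Arc u v = does (d ≟ 1 ⊎-dec d ≟ 2 ⊎-dec d ≟ 4)
  where d = (7 + toℕ v ∸ toℕ u) % 7

-- Since -1 is not a square modulo 7, exactly one of two opposite nonzero differences is a square.
-- With 49 pairs, evaluation decides this.
paley₇ : OrientedGraph
paley₇ = record
  { size     = 7
  ; arc      = paley₇Arc
  ; loopless = from-yes (all? λ v → paley₇Arc v v Bool.≟ false)
  ; asym     = from-yes (all? λ u → all? λ v →
                 paley₇Arc u v Bool.≟ true →-dec paley₇Arc v u Bool.≟ false)
  }

paley₇-isTournament : IsTournament paley₇
paley₇-isTournament = from-yes (all? λ u → all? λ v →
  ¬? (u ≟ᶠ v) →-dec (paley₇Arc u v Bool.≟ true ⊎-dec paley₇Arc v u Bool.≟ true))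

paley₇-dominating : Dominating paley₇ 2
paley₇-dominating w =
  let u , u→w₀ , u→w₁ = pair (w zero) (w (suc zero))
  in u , λ { zero → u→w₀ ; (suc zero) → u→w₁ }
  where
  -- `all?` ranges over `Fin`, not over functions, so the search runs over the two values of `w`.
  pair : ∀ x y → ∃ λ u → Arc paley₇ u x × Arc paley₇ u y
  pair = from-yes (all? λ x → all? λ y → any? λ u →
    paley₇Arc u x Bool.≟ true ×-dec paley₇Arc u y Bool.≟ true)

-- The empty tournament satisfies `Dominating` vacuously here, so a vertex is supplied separately.
dominatingTournament : ∀ k → ∃ λ T → IsTournament T × Fin (size T) × Dominating T (2 + k)
dominatingTournament zero    = paley₇ , paley₇-isTournament , zero , paley₇-dominating
dominatingTournament (suc k) with T , _ , t , dom ← dominatingTournament k =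
  Cube.completion T , Cube.completion-isTournament T , funToFin {3} (const t) ,
  Cube.dominating-cube T dom

-- Lists and powers.

enumerate : ∀ {A : Set} {k} → A → (xs : List A) → length xs ≤ k →
  ∃ λ (w : Fin k → A) → ∀ {x} → x ∈ xs → ∃ λ i → w i ≡ x
-- `Dominating` takes exactly `k` vertices, so the positions beyond the end of the list are filled
-- with `a`.
enumerate a []       _         = const a , λ ()
enumerate a (x ∷ xs) (s≤s len) with w , covers ← enumerate a xs len =
  (x ∷ᶠ w) , λ { (here refl)  → zero , refl
               ; (there x∈xs) → let i , eq = covers x∈xs in suc i , eq }

AllPairs-lookup : ∀ {A : Set} {R : A → A → Set} {xs} → AllPairs R xs →
  ∀ i j → toℕ i < toℕ j → R (lookup xs i) (lookup xs j)
AllPairs-lookup (r ∷ _)  zero    (suc j) _   = All.lookup r (∈-lookup j)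
AllPairs-lookup (_ ∷ rs) (suc i) (suc j) i<j = AllPairs-lookup rs i j (s<s⁻¹ i<j)

Linked-++⁻ˡ : ∀ {A : Set} {R : A → A → Set} xs {ys} → Linked R (xs ++ ys) → Linked R xs
Linked-++⁻ˡ []           _       = []
Linked-++⁻ˡ (x ∷ [])     _       = [-]
Linked-++⁻ˡ (x ∷ y ∷ xs) (r ∷ l) = r ∷ Linked-++⁻ˡ (y ∷ xs) l

^-cancelʳ-≤ : ∀ {m n} b → 0 < b → m ^ b ≤ n ^ b → m ≤ n
^-cancelʳ-≤ b 0<b le = ≮⇒≥ λ n<m → <⇒≱ (^-monoˡ-< b {{>-nonZero 0<b}} n<m) le

m≤m^n : ∀ m {n} → 0 < n → m ≤ m ^ n
m≤m^n zero      _         = z≤n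
m≤m^n m@(suc _) {suc n} _ = m≤m*n m (m ^ n) {{m^n≢0 m n}}

-- Heights of acyclic oriented graphs.

module _ (H : OrientedGraph) where

  IsHeight : (Fin (size H) → ℕ) → Set
  IsHeight h = ∀ {u v} → Arc H u v → h v < h u

  out : Fin (size H) → List (Fin (size H))
  out v = filterᵇ (arc H v) (allFin (size H))

  Arc⇒∈-out : ∀ {u v} → Arc H u v → v ∈ out u
  Arc⇒∈-out {u} {v} a =
    ∈-filter⁺ (T? ∘ arc H u) (∈-allFin v) (Equivalence.from Bool.T-≡ a)

  ∈-out⇒Arc : ∀ {u v} → v ∈ out u → Arc H u v
  ∈-out⇒Arc {u} v∈ =
    Equivalence.to Bool.T-≡ (proj₂ (∈-filter⁻ (T? ∘ arc H u) {xs = allFin (size H)} v∈))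

  -- The largest number of arcs, capped at n, of a walk from v.
  walkLength : ℕ → Fin (size H) → ℕ
  walkLength zero    v = 0
  walkLength (suc n) v = max 0 (map (suc ∘ walkLength n) (out v))

  walkLength-walk : ∀ n v → ∃ λ vs → Linked (Arc H) (v ∷ vs) × length vs ≡ walkLength n v
  walkLength-walk zero    v = [] , [-] , refl
  -- The maximum is either the default 0, realised by the trivial walk, or comes from an
  -- out-neighbour, whose walk is prolonged by `v`.
  walkLength-walk (suc n) v = argmax-all id
    {P = λ l → ∃ λ vs → Linked (Arc H) (v ∷ vs) × length vs ≡ l}
    ([] , [-] , refl) (All.map⁺ (All.tabulate extend))
    where
    extend : ∀ {w} → w ∈ out v →
      ∃ λ vs → Linked (Arc H) (v ∷ vs) × length vs ≡ suc (walkLength n w)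
    extend {w} w∈ with vs , walk , eq ← walkLength-walk n w =
      w ∷ vs , ∈-out⇒Arc w∈ ∷ walk , cong suc eq

  suc-walkLength≤ : ∀ n {v w} → w ∈ out v → suc (walkLength n w) ≤ walkLength (suc n) v
  suc-walkLength≤ n {v} w∈ =
    All.lookup (xs≤max 0 (map (suc ∘ walkLength n) (out v))) (∈-map⁺ (suc ∘ walkLength n) w∈)

  -- If `v` stays below its cap, then each out-neighbour stays below the cap one smaller, so by
  -- induction no term of the maximum changes.
  walkLength-stable : ∀ n v → walkLength n v < n → walkLength (suc n) v ≡ walkLength n v
  walkLength-stable (suc n) v l<n = cong (max 0) (map-cong-local (All.tabulate λ {w} w∈ →
    cong suc (walkLength-stable n w (≤-trans (suc-walkLength≤ n w∈) (s≤s⁻¹ l<n)))))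

  -- The recursion compares the head under cap `n` with the tail under cap `suc n`; stability brings
  -- both to cap `n`.
  walkLength-isHeight : ∀ n → (∀ v → walkLength n v < n) → IsHeight (walkLength n)
  walkLength-isHeight n bound {u} a = subst (_ <_) (walkLength-stable n u (bound u))
    (suc-walkLength≤ n (Arc⇒∈-out a))

  -- The stretch of a walk between two visits to one vertex would be a directed cycle.
  walk-unique : Acyclic H → ∀ {vs} → Linked (Arc H) vs → Unique vs
  walk-unique acyclic {[]}     _    = []
  walk-unique acyclic {v ∷ vs} walk =
    All.¬Any⇒All¬ vs v∉vs ∷ walk-unique acyclic (Linked.tail walk)
    where
    v∉vs : v ∉ vs
    v∉vs v∈vs with ys , zs , refl ← ∈-∃++ v∈vs = acyclic v ys
      (Linked-++⁻ˡ (v ∷ ys ++ v ∷ [])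
        (subst (λ l → Linked (Arc H) (v ∷ l)) (sym (++-assoc ys (v ∷ []) zs)) walk))

  -- A walk with `l` arcs is a path on `l + 1` vertices, so `l < p` and the cap `p` is never
  -- reached.
  acyclic-height : ∀ {p} → Acyclic H → (∀ vs → IsDirectedPath H vs → length vs ≤ p) →
    ∃ λ h → IsHeight h × (∀ v → h v < p)
  acyclic-height {p} acyclic longest = walkLength p , walkLength-isHeight p bound , bound
    where
    bound : ∀ v → walkLength p v < p
    bound v with vs , walk , eq ← walkLength-walk p v =
      subst (_< p) eq (longest (v ∷ vs) (walk-unique acyclic walk , walk))

  -- Homomorphisms built along a height.

  height-hom-transitive : ∀ (T : OrientedGraph) {p h vs} → IsHeight h → (∀ v → h v < p) →
    IsTransitiveSub T vs → p ≤ length vs → Hom H T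
  height-hom-transitive T {p} {h} {vs} isHeight h<p trans-vs p≤len =
    lookup vs ∘ index , λ u v a → AllPairs-lookup trans-vs (index u) (index v)
      (subst₂ _<_ (sym (toℕ-fromℕ< (index-bound u))) (sym (toℕ-fromℕ< (index-bound v)))
        (∸-monoʳ-< (s≤s (isHeight a)) (h<p u)))
    where
    -- Arcs lower the height but go forward in `vs`, so heights are reversed: height `p - 1` goes to
    -- position 0.
    index-bound : ∀ v → p ∸ suc (h v) < length vs
    index-bound v = ≤-trans (∸-monoʳ-< {p} {suc (h v)} {0} (s≤s z≤n) (h<p v)) p≤len

    index : Fin (size H) → Fin (length vs)
    index v = fromℕ< (index-bound v)

  dominating-hom : ∀ (T : OrientedGraph) {k p h} → Fin (size T) → Dominating T k → OutDegAtMost H k →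
    IsHeight h → (∀ v → h v < p) → Hom H T
  dominating-hom T {k} {p} {h} t₀ dom outDeg isHeight h<p =
    let f , hom = partialHom p in f , λ u v a → hom (h<p u) a
    where
    partialHom : ∀ n → ∃ λ (f : Fin (size H) → Fin (size T)) →
      ∀ {u v} → h u < n → Arc H u v → Arc T (f u) (f v)
    partialHom zero = const t₀ , λ ()
    partialHom (suc n) with f , hom ← partialHom n = f′ , hom′
      where
      cover : ∀ v → ∃ λ (w : Fin k → Fin (size H)) → ∀ {x} → x ∈ out v → ∃ λ i → w i ≡ x
      cover v = enumerate v (out v) (outDeg v)

      dominator : ∀ v → ∃ λ x → ∀ i → Arc T x (f (proj₁ (cover v) i))
      dominator v = dom (f ∘ proj₁ (cover v))

      -- Only the values at height `n` matter at this stage; those above it are overwritten later.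
      f′ : Fin (size H) → Fin (size T)
      f′ v = if does (h v <? n) then f v else proj₁ (dominator v)

      f′≡f : ∀ {v} → h v < n → f′ v ≡ f v
      f′≡f {v} h<n rewrite dec-true (h v <? n) h<n = refl

      dominator-arc : ∀ {u v} → Arc H u v → Arc T (proj₁ (dominator u)) (f v)
      dominator-arc {u} a with i , refl ← proj₂ (cover u) (Arc⇒∈-out a) = proj₂ (dominator u) i

      hom′ : ∀ {u v} → h u < suc n → Arc H u v → Arc T (f′ u) (f′ v)
      hom′ {u} {v} hu<1+n a
        -- The head of the arc has height below `n`, so its image is already final.
        rewrite f′≡f {v} (≤-trans (isHeight a) (s≤s⁻¹ hu<1+n))
        with h u <? n
      ... | yes hu<n rewrite dec-true (h u <? n) hu<n  = hom hu<n a
      ... | no  hu≮n rewrite dec-false (h u <? n) hu≮n = dominator-arc a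

theorem9 : ErdosHajnalTournaments →
    ∀ (k : ℕ) → Σ ℕ λ c → Σ ℕ λ d →
    ∀ (H : OrientedGraph) (p : ℕ) → Acyclic H → OutDegAtMost H k →
    IsMaxPathSize H p → τ≤ H (c * p ^ d)
theorem9 erdősHajnal k
  with U , U-tournament , u₀ , U-dom ← dominatingTournament k
  with a , b , 0<a , 0<b , split ← erdősHajnal U U-tournament
  -- As `a` is at least 1, the exponent `a / b` is at least `1 / b`, so `p ^ b` vertices suffice.
  = 1 , b , compress
  where
  compress : ∀ (H : OrientedGraph) (p : ℕ) → Acyclic H → OutDegAtMost H k →
    IsMaxPathSize H p → τ≤ H (1 * p ^ b)
  compress H p acyclic outDeg (_ , longest)
    with h , isHeight , h<p ← acyclic-height H acyclic longest
    = p ^ b , ≤-reflexive (sym (*-identityˡ (p ^ b))) , toTournament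
    where
    H→U : Hom H U
    -- `U` dominates `2 + k` vertices, so the out-degree bound is relaxed by 2.
    H→U = dominating-hom H U u₀ U-dom (λ v → ≤-trans (outDeg v) (m≤n+m k 2)) isHeight h<p

    toTournament : CompressesTo H (p ^ b)
    toTournament T size≡ T-tournament with split T T-tournament
    ... | inj₁ ((g , g-hom) , _) = g ∘ proj₁ H→U , λ u v a → g-hom _ _ (proj₂ H→U u v a)
    ... | inj₂ (vs , trans-vs , size^a≤) =
      height-hom-transitive H T isHeight h<p trans-vs (^-cancelʳ-≤ b 0<b (begin
        p ^ b           ≤⟨ m≤m^n (p ^ b) 0<a ⟩
        (p ^ b) ^ a     ≡⟨ cong (_^ a) (sym size≡) ⟩
        size T ^ a      ≤⟨ size^a≤ ⟩
        length vs ^ b   ∎))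
      where open ≤-Reasoning
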